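{- There exists an infinite family of strings, containing strings of arbitrarily large length $n$, and a constant $C>0$ such that every string $w$ of length $n\ge 2$ in the family satisfies $\ell(w) \ge C\,\delta(w)\log n$; that is, $\ell = \Omega(\delta\log n)$ on this family.
   Context: For a string $w[1,n]$, let $S_w(k)$ be the number of distinct substrings of length $k$ of $w$, and $\delta(w) = \max\{S_w(k)/k : 1\le k\le n\}$. L-system: a tuple $L=(V,R,S,\tau,d,n)$ where $V$ is a finite set of variables, $R: V\to V^+$ assigns to each variable a nonempty string (extended homomorphically to strings), $S\in V^*$ is the axiom, $\tau: V\to V$ is a coding (letter-to-letter map, extended homomorphically), $d\in\mathbb{N}$ and $n\in\mathbb{N}$. Its levels are $L_0=S$ and $L_{i+1}=R(L_i)$; it generates the string $w[1,n]=\tau(L_d[1,n])$. Its size is $|S|+\sum_{A\in V}|R(A)|$. $\ell(w)$ is the size of the smallest L-system generating $w$. -}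

module Defs where

open import Data.Nat using (ℕ; zero; suc; _+_; _∸_; _≤_)
import Data.Nat.Properties as ℕₚ
open import Data.Nat.Logarithm using (⌊log₂_⌋)
open import Data.Fin using (Fin)
open import Data.Nat.ListAction using (sum)
open import Data.List using (List; []; _∷_; length; map; take; drop; concatMap; allFin; deduplicate; foldr; upTo)
open import Data.List.Properties using (≡-dec)
open import Data.List.NonEmpty using (List⁺) renaming (toList to toList⁺; length to length⁺)
open import Data.Integer using (+_)
open import Data.Rational using (ℚ; _/_; _⊔_; 0ℚ; _*_)
open import Function using (_∘_)
open import Function.Definitions using (Injective)
open import Relation.Binary.PropositionalEquality using (_≡_)

-- Strings are lists of letters; letters are natural numbers (an arbitrary countable alphabet).
Str : Set
Str = List ℕ

windows : ℕ → Str → List Str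
windows k w = map (λ i → take k (drop i w)) (upTo (suc (length w ∸ k)))

-- S_w(k): number of distinct substrings of length k (only meaningful for 1 ≤ k ≤ n)
S : Str → ℕ → ℕ
S w k = length (deduplicate (≡-dec ℕₚ._≟_) (windows k w))

δ : Str → ℚ
δ w = foldr _⊔_ 0ℚ (map (λ j → (+ S w (suc j)) / suc j) (upTo (length w)))

-- V is a finite set of m variables, represented as Fin m; `name` identifies
-- each variable with a letter (injectively), so that strings over V are strings of ℕ.
record LSystem : Set where
  field
    m     : ℕ
    name  : Fin m → ℕ
    name-inj : Injective _≡_ _≡_ name
    R     : Fin m → List⁺ (Fin m)
    axiom : List (Fin m)
    τ     : Fin m → Fin m
    d     : ℕ
    n     : ℕ

  applyR : List (Fin m) → List (Fin m)
  applyR = concatMap (toList⁺ ∘ R)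

  level : ℕ → List (Fin m)
  level zero    = axiom
  level (suc i) = applyR (level i)

  size : ℕ
  size = length axiom + sum (map (λ A → length⁺ (R A)) (allFin m))

open LSystem public

Generates : LSystem → Str → Set
Generates L w =
  (n L ≡ length w) × (n L ≤ length (level L (d L))) ×
  (map (name L ∘ τ L) (take (n L) (level L (d L))) ≡ w)
  where open import Data.Product using (_×_)

{-# OPTIONS --safe #-}

-- Let w have length 2^(2k+1) and k ones, the j-th at distance less than 2^k
-- after position 2^(k+1+j). The gaps between the ones grow like their positions,
-- so apart from the first 4l windows every window of length l contains at most
-- one 1, and δ(w) ≤ 6. There are (2^k)^k such words. On the other hand, an
-- L-system of size at most t generates few words of length n, whatever its depth:
-- with φ = R^(t!), the first letter of φ(A) depends idempotently on A, which makes
-- the prefix of length n of φʲ(x) constant for j ≥ n, so only t!(n+1) depths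
-- matter. All such systems have at most 2^(4t² + O(t)) codes, fewer than (2^k)^k
-- when k = 5t, and the pigeonhole principle exhibits a word that needs size more
-- than t, while log n = 10t + 1.

module Submission where

open import Defs
open import Data.Nat
open import Data.Nat.Properties
open import Algebra.Properties.CommutativeSemigroup +-commutativeSemigroup using (x∙yz≈y∙xz)
open import Data.Nat.Divisibility using (_∣_; divides; m≤n⇒m!∣n!; ∣-trans; ∣⇒≤; m∣m*n)
open import Data.Nat.DivMod using (_/_; _%_; m≡m%n+[m/n]*n; m%n<n)
open import Data.Nat.GeneralisedArithmetic using (fold; fold-+)
open import Data.Nat.ListAction using (sum)
open import Data.Nat.Logarithm using (⌊log₂_⌋; ⌊log₂[2^n]⌋≡n)
open import Data.Nat.Solver using (module +-*-Solver)
import Data.Integer as ℤ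
import Data.Integer.Properties as ℤₚ
open import Data.Rational as ℚ using (ℚ; 0ℚ) renaming (_≤_ to _≤ℚ_)
import Data.Rational.Properties as ℚₚ
open import Data.Rational.Unnormalised as ℚᵘ using (mkℚᵘ)
import Data.Rational.Unnormalised.Properties as ℚᵘₚ
open import Data.Fin using (Fin; toℕ; zero; suc; inject≤; fromℕ<)
open import Data.Fin.Properties
  using (any?; ¬∀⟶∃¬; pigeonhole; injective⇒≤; *↔×; toℕ<n; toℕ-fromℕ<; toℕ-injective)
open import Data.List
  using (List; []; _∷_; [_]; _++_; length; take; drop; map; concatMap; foldr; allFin; applyUpTo; upTo)
open import Data.List.Properties
  using (≡-dec; ++-assoc; ++-identityʳ; length-++; length-map; length-upTo; length-applyUpTo; length-tabulate;
         map-++; map-∘; map-cong; map-applyUpTo; map-concatMap; concatMap-++; concatMap-map; concatMap-cong;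
         take-map; take-all; ∷-injectiveˡ; ∷-injectiveʳ)
open import Data.List.NonEmpty using (List⁺; _∷_; head; tail) renaming (toList to toList⁺; length to length⁺)
open import Data.List.Membership.Propositional using (_∈_)
open import Data.List.Membership.Propositional.Properties
  using (∈-allFin; ∈-map⁺; ∈-map⁻; ∈-++⁺ˡ; ∈-++⁺ʳ; ∈-++⁻; ∈-upTo⁺; ∈-upTo⁻; ∈-deduplicate⁻; ∈-∃++)
open import Data.List.Relation.Unary.Any using (here; there)
open import Data.List.Relation.Unary.All as All using (All; []; _∷_)
import Data.List.Relation.Unary.All.Properties as Allₚ
open import Data.List.Relation.Unary.AllPairs using ([]; _∷_)
open import Data.List.Relation.Unary.Unique.Propositional using (Unique)
open import Data.List.Relation.Unary.Unique.DecPropositional.Properties using (deduplicate-!)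
open import Data.Vec as Vec using (Vec; []; _∷_; lookup; toList; padRight; tabulate)
open import Data.Vec.Properties using (length-toList; lookup∘tabulate; tabulate∘lookup; tabulate-cong)
open import Data.Product using (Σ; _×_; _,_; proj₁; proj₂; ∃; ∃₂; map₂; uncurry)
open import Data.Product.Function.NonDependent.Propositional using (_×-↔_)
open import Data.Sum using (inj₁; inj₂)
open import Function using (_∘_; _↔_; mk↔ₛ′; Inverse)
open import Function.Construct.Composition using (_↔-∘_)
open import Function.Construct.Symmetry using (↔-sym)
open import Function.Construct.Identity using (↔-id)
open import Function.Definitions using (Injective)
open import Relation.Nullary using (Dec; yes; no; ¬_; contradiction)
open import Relation.Binary using (DecidableEquality; tri<; tri≈; tri>)
open import Relation.Binary.PropositionalEquality hiding ([_])

-- Iterates of a map on a finite set.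

n∣n! : ∀ n .{{_ : NonZero n}} → n ∣ n !
n∣n! (suc n) = m∣m*n (n !)

n≤n! : ∀ n → n ≤ n !
n≤n! zero      = z≤n
n≤n! n@(suc _) = ∣⇒≤ {{n !≢0}} (n∣n! n)

module _ {A : Set} (h : A → A) where

  fold-suc : ∀ z i → fold z h (suc i) ≡ fold (h z) h i
  fold-suc z zero    = refl
  fold-suc z (suc i) = cong h (fold-suc z i)

  fold-fixed : ∀ {z} → h z ≡ z → ∀ i → fold z h i ≡ z
  fold-fixed eq zero    = refl
  fold-fixed eq (suc i) = trans (cong h (fold-fixed eq i)) eq

  fold-* : ∀ c {g : A → A} → (∀ z → g z ≡ fold z h c) → ∀ z q → fold z g q ≡ fold z h (q * c)
  fold-* c g≗ z zero    = refl
  fold-* c g≗ z (suc q) =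
    trans (g≗ _) (trans (cong (λ y → fold y h c) (fold-* c g≗ z q)) (sym (fold-+ z h c)))

  fold-period : ∀ {z c i} → fold z h (c + i) ≡ fold z h i → ∀ q {r} → i ≤ r → fold z h (q * c + r) ≡ fold z h r
  fold-period eq zero i≤r = refl
  fold-period {z} {c} {i} eq (suc q) {r} i≤r = begin
    fold z h (c + q * c + r)               ≡⟨ cong (fold z h) (+-assoc c (q * c) r) ⟩
    fold z h (c + (q * c + r))             ≡⟨ cong (λ x → fold z h (c + x)) (m∸n+n≡m i≤qc+r) ⟨
    fold z h (c + (p + i))                 ≡⟨ cong (fold z h) (x∙yz≈y∙xz c p i) ⟩
    fold z h (p + (c + i))                 ≡⟨ fold-+ z h p ⟩
    fold (fold z h (c + i)) h p            ≡⟨ cong (λ x → fold x h p) eq ⟩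
    fold (fold z h i) h p                  ≡⟨ fold-+ z h p ⟨
    fold z h (p + i)                       ≡⟨ cong (fold z h) (m∸n+n≡m i≤qc+r) ⟩
    fold z h (q * c + r)                   ≡⟨ fold-period eq q i≤r ⟩
    fold z h r                             ∎
    where
    open ≡-Reasoning
    p = (q * c + r) ∸ i
    i≤qc+r : i ≤ q * c + r
    i≤qc+r = ≤-trans i≤r (m≤n+m r (q * c))

-- Among the first `m + 1` iterates of `z` two coincide. Their distance is at most `t` and so
-- divides `t !`, and the orbit is periodic from an index at most `t !` on. Hence the single
-- exponent `t !` serves every map `h` on at most `t` points.
fold-!-idempotent : ∀ {m t} → m ≤ t → (h : Fin m → Fin m) → ∀ z →
                    fold (fold z h (t !)) h (t !) ≡ fold z h (t !)
fold-!-idempotent {m} {t} m≤t h z with pigeonhole (n<1+n m) (λ i → fold z h (toℕ i))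
... | i , j , i<j , eq with ∣-trans (n∣n! c) (m≤n⇒m!∣n! c≤t)
  where
  c = toℕ j ∸ toℕ i
  instance
    c≢0 : NonZero c
    c≢0 = >-nonZero (m<n⇒0<n∸m i<j)
  c≤t : c ≤ t
  c≤t = ≤-trans (m∸n≤m (toℕ j) (toℕ i)) (≤-trans (≤-pred (toℕ<n j)) m≤t)
...   | divides q t!≡qc = begin
  fold (fold z h (t !)) h (t !)         ≡⟨ fold-+ z h (t !) ⟨
  fold z h (t ! + t !)                  ≡⟨ cong (λ x → fold z h (x + t !)) t!≡qc ⟩
  fold z h (q * (toℕ j ∸ toℕ i) + t !)  ≡⟨ fold-period h {i = toℕ i} period q i≤t! ⟩
  fold z h (t !)                        ∎
  where
  open ≡-Reasoning
  period : fold z h (toℕ j ∸ toℕ i + toℕ i) ≡ fold z h (toℕ i)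
  period = trans (cong (fold z h) (m∸n+n≡m (<⇒≤ i<j))) (sym eq)
  i≤t! : toℕ i ≤ t !
  i≤t! = ≤-trans (≤-pred (toℕ<n i)) (≤-trans m≤t (n≤n! t))

-- Iterated substitutions and their prefixes.

take-++ˡ : ∀ {A : Set} n (xs : List A) {ys} → n ≤ length xs → take n (xs ++ ys) ≡ take n xs
take-++ˡ zero    xs       _         = refl
take-++ˡ (suc n) (x ∷ xs) (s≤s n≤l) = cong (x ∷_) (take-++ˡ n xs n≤l)

module _ {A : Set} where

  substitute : (A → List⁺ A) → List A → List A
  substitute ρ = concatMap (toList⁺ ∘ ρ)

  -- Composition of substitutions, `σ` first. The head is spelled out so that the first letter of a
  -- composite reduces to the composite of the first-letter maps.
  _⊙_ : (A → List⁺ A) → (A → List⁺ A) → A → List⁺ A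
  (ρ ⊙ σ) a = head (ρ (head (σ a))) ∷ (tail (ρ (head (σ a))) ++ substitute ρ (tail (σ a)))

  substitute-⊙ : ∀ ρ σ xs → substitute (ρ ⊙ σ) xs ≡ substitute ρ (substitute σ xs)
  substitute-⊙ ρ σ []       = refl
  substitute-⊙ ρ σ (x ∷ xs) = trans
    (cong (toList⁺ ((ρ ⊙ σ) x) ++_) (substitute-⊙ ρ σ xs))
    (sym (concatMap-++ (toList⁺ ∘ ρ) (toList⁺ (σ x)) (substitute σ xs)))

  power : (A → List⁺ A) → ℕ → A → List⁺ A
  power ρ zero    a = a ∷ []
  power ρ (suc i)   = ρ ⊙ power ρ i

  head-power : ∀ ρ i a → head (power ρ i a) ≡ fold a (head ∘ ρ) i
  head-power ρ zero    a = refl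
  head-power ρ (suc i) a = cong (head ∘ ρ) (head-power ρ i a)

  substitute-power : ∀ ρ i xs → substitute (power ρ i) xs ≡ fold xs (substitute ρ) i
  substitute-power ρ zero []       = refl
  substitute-power ρ zero (x ∷ xs) = cong (x ∷_) (substitute-power ρ zero xs)
  substitute-power ρ (suc i) xs =
    trans (substitute-⊙ ρ (power ρ i) xs) (cong (substitute ρ) (substitute-power ρ i xs))

  module _ (ρ : A → List⁺ A) where

    private
      _↑_ : List A → ℕ → List A
      xs ↑ i = fold xs (substitute ρ) i

    fold-++ : ∀ xs ys i → (xs ++ ys) ↑ i ≡ (xs ↑ i) ++ (ys ↑ i)
    fold-++ xs ys zero    = refl
    fold-++ xs ys (suc i) =
      trans (cong (substitute ρ) (fold-++ xs ys i)) (concatMap-++ (toList⁺ ∘ ρ) (xs ↑ i) (ys ↑ i))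

    fold-nonempty : ∀ a xs i → 1 ≤ length ((a ∷ xs) ↑ i)
    fold-nonempty a xs zero    = s≤s z≤n
    fold-nonempty a xs (suc i) = subst (λ l → 1 ≤ length l) (sym (fold-suc (substitute ρ) (a ∷ xs) i)) (fold-nonempty _ _ i)

    -- Let b be the first letter after one step. If ρ b is longer than b, the
    -- words ρʲ(b) are proper prefixes of one another; otherwise b is a fixed
    -- first letter and the remaining word is handled by induction on n.
    take-stable : (∀ a → head (ρ (head (ρ a))) ≡ head (ρ a)) →
                  ∀ n xs {j} → n ≤ j → take n (xs ↑ suc j) ≡ take n (xs ↑ j)
    take-stable idem zero    xs       _         = refl
    take-stable idem (suc n) []       {suc j} _ =
      cong (take (suc n)) (trans (fold-fixed (substitute ρ) refl (2+ j))
                                 (sym (fold-fixed (substitute ρ) refl (suc j))))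
    take-stable idem (suc n) (a ∷ xs) {suc j} (s≤s n≤j) = begin
      -- One step is spent on reaching the first letter `b`, which idempotence then preserves.
      -- Afterwards `j` steps remain, and `n ≤ j` is enough to fill `suc n` letters.
      take (suc n) ((a ∷ xs) ↑ (2+ j))   ≡⟨ cong (take (suc n)) (fold-suc (substitute ρ) (a ∷ xs) (suc j)) ⟩
      take (suc n) ((b ∷ ys) ↑ suc j)    ≡⟨ from-b (tail (ρ b)) refl ⟩
      take (suc n) ((b ∷ ys) ↑ j)        ≡⟨ cong (take (suc n)) (fold-suc (substitute ρ) (a ∷ xs) j) ⟨
      take (suc n) ((a ∷ xs) ↑ suc j)    ∎
      where
      open ≡-Reasoning
      b  = head (ρ a)
      ys = tail (ρ a) ++ substitute ρ xs

      b-step : ∀ {u} → tail (ρ b) ≡ u → [ b ] ↑ 1 ≡ b ∷ u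
      b-step eq = cong₂ _∷_ (idem a) (trans (++-identityʳ _) eq)

      from-b : ∀ u → tail (ρ b) ≡ u → take (suc n) ((b ∷ ys) ↑ suc j) ≡ take (suc n) ((b ∷ ys) ↑ j)
      from-b [] eq = begin
        take (suc n) ((b ∷ ys) ↑ suc j)  ≡⟨ cong (take (suc n)) (fixed (suc j)) ⟩
        b ∷ take n (ys ↑ suc j)          ≡⟨ cong (b ∷_) (take-stable idem n ys n≤j) ⟩
        b ∷ take n (ys ↑ j)              ≡⟨ cong (take (suc n)) (fixed j) ⟨
        take (suc n) ((b ∷ ys) ↑ j)      ∎
        where
        fixed : ∀ i → (b ∷ ys) ↑ i ≡ b ∷ (ys ↑ i)
        fixed i = trans (fold-++ [ b ] ys i) (cong (_++ (ys ↑ i)) (fold-fixed (substitute ρ) (b-step eq) i))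
      from-b (v ∷ vs) eq = begin
        take (suc n) ((b ∷ ys) ↑ suc j)                                 ≡⟨ cong (take (suc n)) (fold-++ [ b ] ys (suc j)) ⟩
        take (suc n) (([ b ] ↑ suc j) ++ (ys ↑ suc j))                  ≡⟨ cong (λ l → take (suc n) (l ++ (ys ↑ suc j))) (grow j) ⟩
        take (suc n) ((([ b ] ↑ j) ++ (u ↑ j)) ++ (ys ↑ suc j))         ≡⟨ cong (take (suc n)) (++-assoc ([ b ] ↑ j) _ _) ⟩
        take (suc n) (([ b ] ↑ j) ++ ((u ↑ j) ++ (ys ↑ suc j)))         ≡⟨ take-++ˡ (suc n) ([ b ] ↑ j) n<len ⟩
        take (suc n) ([ b ] ↑ j)                                        ≡⟨ take-++ˡ (suc n) ([ b ] ↑ j) n<len ⟨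
        take (suc n) (([ b ] ↑ j) ++ (ys ↑ j))                          ≡⟨ cong (take (suc n)) (fold-++ [ b ] ys j) ⟨
        take (suc n) ((b ∷ ys) ↑ j)                                     ∎
        where
        u = v ∷ vs
        grow : ∀ i → [ b ] ↑ suc i ≡ ([ b ] ↑ i) ++ (u ↑ i)
        grow i = trans (fold-suc (substitute ρ) [ b ] i)
                       (trans (cong (_↑ i) (b-step eq)) (fold-++ [ b ] u i))
        len : ∀ i → i < length ([ b ] ↑ i)
        len zero    = s≤s z≤n
        len (suc i) = subst₂ _<_ (+-comm i 1) (sym (trans (cong length (grow i)) (length-++ ([ b ] ↑ i))))
                        (+-mono-<-≤ (len i) (fold-nonempty v vs i))
        n<len : suc n ≤ length ([ b ] ↑ j)
        n<len = ≤-trans (s≤s n≤j) (len j)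

    take-constant : (∀ a → head (ρ (head (ρ a))) ≡ head (ρ a)) →
                    ∀ n xs j → take n (xs ↑ (j + n)) ≡ take n (xs ↑ n)
    take-constant idem n xs zero    = refl
    take-constant idem n xs (suc j) = trans (take-stable idem n xs (m≤n+m n j)) (take-constant idem n xs j)

-- Write `d` as `q * t ! + r`: after `r` single steps come `q` rounds of `φ`, whose first-letter map
-- is idempotent. The prefix of length `n` no longer changes after `n` rounds, so `q` may be lowered
-- to `n` when it is larger.
prefix-depth : ∀ {m t} → m ≤ t → (ρ : Fin m → List⁺ (Fin m)) → ∀ n xs d →
               ∃ λ e → e < t ! * suc n × take n (fold xs (substitute ρ) e) ≡ take n (fold xs (substitute ρ) d)
prefix-depth {m} {t} m≤t ρ n xs d = cut (≤-total q n)
  where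
  instance
    t!≢0 : NonZero (t !)
    t!≢0 = t !≢0
  q = d / t !
  r = d % t !
  φ : Fin m → List⁺ (Fin m)
  φ = power ρ (t !)
  ys = fold xs (substitute ρ) r

  idem : ∀ a → head (φ (head (φ a))) ≡ head (φ a)
  idem a rewrite head-power ρ (t !) a | head-power ρ (t !) (fold a (head ∘ ρ) (t !)) =
    fold-!-idempotent m≤t (head ∘ ρ) a

  iterate-φ : ∀ j → fold xs (substitute ρ) (j * t ! + r) ≡ fold ys (substitute φ) j
  iterate-φ j = trans (fold-+ xs (substitute ρ) (j * t !))
                      (sym (fold-* (substitute ρ) (t !) (substitute-power ρ (t !)) ys j))

  d≡ : d ≡ q * t ! + r
  d≡ = trans (m≡m%n+[m/n]*n d (t !)) (+-comm r (q * t !))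

  small : ∀ {j} → j ≤ n → j * t ! + r < t ! * suc n
  small {j} j≤n = begin-strict
    j * t ! + r    <⟨ +-mono-≤-< (*-monoˡ-≤ (t !) j≤n) (m%n<n d (t !)) ⟩
    n * t ! + t !  ≡⟨ +-comm (n * t !) (t !) ⟩
    suc n * t !    ≡⟨ *-comm (suc n) (t !) ⟩
    t ! * suc n    ∎
    where open ≤-Reasoning

  cut : _ → _
  cut (inj₁ q≤n) = d , subst (_< t ! * suc n) (sym d≡) (small q≤n) , refl
  cut (inj₂ n≤q) = n * t ! + r , small ≤-refl , (begin
    take n (fold xs (substitute ρ) (n * t ! + r))  ≡⟨ cong (take n) (iterate-φ n) ⟩
    take n (fold ys (substitute φ) n)              ≡⟨ take-constant φ idem n ys (q ∸ n) ⟨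
    take n (fold ys (substitute φ) (q ∸ n + n))    ≡⟨ cong (λ j → take n (fold ys (substitute φ) j)) (m∸n+n≡m n≤q) ⟩
    take n (fold ys (substitute φ) q)              ≡⟨ cong (take n) (iterate-φ q) ⟨
    take n (fold xs (substitute ρ) (q * t ! + r))  ≡⟨ cong (λ e → take n (fold xs (substitute ρ) e)) d≡ ⟨
    take n (fold xs (substitute ρ) d)              ∎)
    where open ≡-Reasoning

-- Pigeonhole and the cardinality of finite types.

-- If every `g i` were a value of `f`, choosing a preimage for each would inject `Fin N` into
-- `Fin M`. Decidable equality and finiteness turn the failure of covering into an explicit index.
¬covers : ∀ {A : Set} {M N} → DecidableEquality A → M < N → (f : Fin M → A) (g : Fin N → A) →
          Injective _≡_ _≡_ g → ∃ λ i → ∀ j → f j ≢ g i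
¬covers {N = N} _≟ᴬ_ M<N f g g-inj = map₂ (λ ¬∃ j eq → ¬∃ (j , eq))
  (¬∀⟶∃¬ N (λ i → ∃ λ j → f j ≡ g i) (λ i → any? λ j → f j ≟ᴬ g i) λ cover →
    <⇒≱ M<N (injective⇒≤ {f = proj₁ ∘ cover} λ {i} {i′} eq →
      g-inj (trans (sym (proj₂ (cover i))) (trans (cong f eq) (proj₂ (cover i′))))))

Vec↔Fin : ∀ {A : Set} {N} → A ↔ Fin N → ∀ k → Vec A k ↔ Fin (N ^ k)
Vec↔Fin A↔ zero    = mk↔ₛ′ (λ _ → zero) (λ _ → []) (λ { zero → refl }) (λ { [] → refl })
Vec↔Fin A↔ (suc k) = ↔-sym *↔× ↔-∘ ((A↔ ×-↔ Vec↔Fin A↔ k) ↔-∘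
  mk↔ₛ′ (λ v → Vec.head v , Vec.tail v) (uncurry _∷_) (λ _ → refl) (λ { (x ∷ xs) → refl }))

×↔Fin : ∀ {A B : Set} {M N} → A ↔ Fin M → B ↔ Fin N → (A × B) ↔ Fin (M * N)
×↔Fin A↔ B↔ = ↔-sym *↔× ↔-∘ (A↔ ×-↔ B↔)

-- Factors of words, and the coding of small L-systems by factors.

module _ {A : Set} where

  Slice : List A → List A → Set
  Slice xs ys = ∃₂ λ pre post → ys ≡ pre ++ (xs ++ post)

  slice-++ˡ : ∀ {xs ys} zs → Slice xs ys → Slice xs (zs ++ ys)
  slice-++ˡ zs (pre , post , refl) = zs ++ pre , post , sym (++-assoc zs pre _)

  slice-++ʳ : ∀ {xs ys} zs → Slice xs ys → Slice xs (ys ++ zs)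
  slice-++ʳ {xs} zs (pre , post , refl) = pre , post ++ zs ,
    trans (++-assoc pre _ zs) (cong (pre ++_) (++-assoc xs post zs))

  slice-concatMap : ∀ {B : Set} (f : B → List A) {x xs} → x ∈ xs → Slice (f x) (concatMap f xs)
  slice-concatMap f (here refl) = [] , _ , refl
  slice-concatMap f {xs = y ∷ _} (there x∈xs) = slice-++ˡ (f y) (slice-concatMap f x∈xs)

  cut : ∀ {t} → List A → Fin (suc t) × Fin (suc t) → List A
  cut ys (o , l) = take (toℕ l) (drop (toℕ o) ys)

  -- A factor is determined by its offset and its length, both at most `t`, so it costs two numbers
  -- below `suc t` however long it is.
  cut-slice : ∀ {t xs ys} → length ys ≤ t → Slice xs ys →
              ∃ λ (p : Fin (suc t) × Fin (suc t)) → cut ys p ≡ xs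
  cut-slice {t} {xs} len (pre , post , refl) = (fromℕ< (s≤s o≤t) , fromℕ< (s≤s l≤t)) ,
    trans (cong₂ (λ o l → take l (drop o (pre ++ (xs ++ post))))
                 (toℕ-fromℕ< (s≤s o≤t)) (toℕ-fromℕ< (s≤s l≤t)))
          (trans (cong (take (length xs)) (drop-length pre))
                 (trans (take-++ˡ (length xs) xs ≤-refl) (take-all (length xs) xs ≤-refl)))
    where
    len′ : length pre + (length xs + length post) ≤ t
    len′ = subst (_≤ t) (trans (length-++ pre) (cong (length pre +_) (length-++ xs))) len
    o≤t = m+n≤o⇒m≤o (length pre) len′
    l≤t = m+n≤o⇒m≤o (length xs) (m+n≤o⇒n≤o (length pre) len′)
    drop-length : ∀ zs {ws : List A} → drop (length zs) (zs ++ ws) ≡ ws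
    drop-length []       = refl
    drop-length (z ∷ zs) = drop-length zs

  toVec : ∀ {k} → A → ∀ xs → length xs ≤ k → ∃₂ λ (v : Vec A k) ys → toList v ≡ xs ++ ys
  toVec {k} a []       _         = Vec.replicate k a , _ , refl
  toVec a (x ∷ xs) (s≤s len) with toVec a xs len
  ... | v , ys , eq = x ∷ v , ys , cong (x ∷_) eq

lookup-padRight : ∀ {A : Set} {m n} (m≤n : m ≤ n) a (v : Vec A m) i →
                  lookup (padRight m≤n a v) (inject≤ i m≤n) ≡ lookup v i
lookup-padRight (s≤s m≤n) a (x ∷ v) zero    = refl
lookup-padRight (s≤s m≤n) a (x ∷ v) (suc i) = lookup-padRight m≤n a v i

slice-map : ∀ {A B : Set} (f : A → B) {xs ys} → Slice xs ys → Slice (map f xs) (map f ys)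
slice-map f {xs} (pre , post , refl) = map f pre , map f post ,
  trans (map-++ f pre (xs ++ post)) (cong (map f pre ++_) (map-++ f xs post))

length-concatMap : ∀ {A B : Set} (f : A → List B) xs → length (concatMap f xs) ≡ sum (map (length ∘ f) xs)
length-concatMap f []       = refl
length-concatMap f (x ∷ xs) = trans (length-++ (f x)) (cong (length (f x) +_) (length-concatMap f xs))

length≤sum : ∀ {A B : Set} (f : A → List⁺ B) xs → length xs ≤ sum (map (length⁺ ∘ f) xs)
length≤sum f []       = z≤n
length≤sum f (x ∷ xs) = s≤s (≤-trans (length≤sum f xs) (m≤n+m _ (length (tail (f x)))))

-- A code consists of a word containing the axiom and all right-hand sides as
-- factors, the position and letter of each variable, the position of the
-- axiom, and the depth.
Code : ℕ → ℕ → Set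
Code t D = Vec (Fin t) t × Vec (Position × Fin 2) t × Position × Fin D
  where Position = Fin (suc t) × Fin (suc t)

#codes : ℕ → ℕ → ℕ
#codes t D = t ^ t * ((suc t * suc t * 2) ^ t * (suc t * suc t * D))

Code↔Fin : ∀ t D → Code t D ↔ Fin (#codes t D)
Code↔Fin t D = ×↔Fin (Vec↔Fin (↔-id _) t)
                     (×↔Fin (Vec↔Fin (×↔Fin position (↔-id _)) t) (×↔Fin position (↔-id _)))
  where position = ×↔Fin (↔-id (Fin (suc t))) (↔-id (Fin (suc t)))

-- Total on all codes: one that comes from no L-system still decodes to some word, which can only
-- enlarge the set of decoded words. The coding and the names of the variables survive only as one
-- output bit per variable.
decode : ∀ {t D} → ℕ → Code t D → Str
decode n (v , rules , p , e) = map (toℕ ∘ proj₂ ∘ lookup rules)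
  (take n (fold (cut (toList v) p) (concatMap (cut (toList v) ∘ proj₁ ∘ lookup rules)) (toℕ e)))

-- Names are arbitrary numbers. Collapsing the nonzero ones to 1 keeps the code finite and leaves a
-- binary word unchanged.
bit : ℕ → Fin 2
bit zero    = zero
bit (suc _) = suc zero

bit-toℕ : ∀ i → bit (toℕ i) ≡ i
bit-toℕ zero       = refl
bit-toℕ (suc zero) = refl

level-fold : ∀ L i → level L i ≡ fold (axiom L) (substitute (R L)) i
level-fold L zero    = refl
level-fold L (suc i) = cong (applyR L) (level-fold L i)

module _ (L : LSystem) {t : ℕ} (size≤t : size L ≤ t) where

  private
    -- Right-hand sides are nonempty, so each variable contributes at least 1 to the size.
    m≤t : m L ≤ t
    m≤t = begin
      m L                   ≡⟨ length-tabulate {n = m L} (λ i → i) ⟨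
      length (allFin (m L)) ≤⟨ length≤sum (R L) (allFin (m L)) ⟩
      _                     ≤⟨ m≤n+m _ (length (axiom L)) ⟩
      size L                ≤⟨ size≤t ⟩
      t                     ∎
      where open ≤-Reasoning

    ι : Fin (m L) → Fin t
    ι i = inject≤ i m≤t

    -- Its length is exactly the size of `L`, so that `t` letters hold it.
    text : List (Fin (m L))
    text = axiom L ++ concatMap (toList⁺ ∘ R L) (allFin (m L))

    length-text : length (map ι text) ≤ t
    length-text = ≤-trans (≤-reflexive (trans (length-map ι text) (trans (length-++ (axiom L))
      (cong (length (axiom L) +_) (length-concatMap (toList⁺ ∘ R L) (allFin (m L))))))) size≤t

  -- The rules cut out of `v` act on the renamed variables as `R L` does on the original ones, so
  -- the two derivations correspond at every depth. The letter `z` only pads `text` to length `t`.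
  encode : Fin t → ∀ {D} (e : Fin D) n u → map (name L ∘ τ L) (take n (level L (toℕ e))) ≡ map toℕ u →
           ∃ λ (c : Code t D) → decode n c ≡ map toℕ u
  encode z {D} e n u gen with toVec z (map ι text) length-text
  ... | v , rest , eq = (v , rules , proj₁ axiom-at , e) , (begin
    map letter (take n (fold (cut (toList v) (proj₁ axiom-at)) (concatMap rule) (toℕ e)))
                                                            ≡⟨ cong (map letter ∘ take n) (simulate (toℕ e)) ⟩
    map letter (take n (map ι (level L (toℕ e))))           ≡⟨ cong (map letter) (take-map n (level L (toℕ e))) ⟩
    map letter (map ι (take n (level L (toℕ e))))           ≡⟨ map-∘ _ ⟨
    map (letter ∘ ι) (take n (level L (toℕ e)))             ≡⟨ map-cong letter-ι _ ⟩
    map (toℕ ∘ bit ∘ name L ∘ τ L) (take n (level L (toℕ e)))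
                                                            ≡⟨ map-∘ _ ⟩
    map (toℕ ∘ bit) (map (name L ∘ τ L) (take n (level L (toℕ e))))
                                                            ≡⟨ cong (map (toℕ ∘ bit)) gen ⟩
    map (toℕ ∘ bit) (map toℕ u)                             ≡⟨ map-∘ u ⟨
    map (toℕ ∘ bit ∘ toℕ) u                                 ≡⟨ map-cong (cong toℕ ∘ bit-toℕ) u ⟩
    map toℕ u                                               ∎)
    where
    open ≡-Reasoning

    at : ∀ {xs} → Slice xs text → ∃ λ (p : Fin (suc t) × Fin (suc t)) → cut (toList v) p ≡ map ι xs
    at sl = cut-slice (≤-reflexive (length-toList v))
      (subst (Slice _) (sym eq) (slice-++ʳ rest (slice-map ι sl)))

    axiom-at = at ([] , _ , refl)

    rule-at : ∀ A → ∃ λ (p : Fin (suc t) × Fin (suc t)) → cut (toList v) p ≡ map ι (toList⁺ (R L A))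
    rule-at A = at (slice-++ˡ (axiom L) (slice-concatMap (toList⁺ ∘ R L) (∈-allFin A)))

    entry : Fin (m L) → (Fin (suc t) × Fin (suc t)) × Fin 2
    entry A = proj₁ (rule-at A) , bit (name L (τ L A))

    -- The default entry belongs to the elements of `Fin t` that are no variable of `L`; they never
    -- occur in the simulated levels.
    rules = padRight m≤t ((zero , zero) , zero) (tabulate entry)

    lookup-ι : ∀ A → lookup rules (ι A) ≡ entry A
    lookup-ι A = trans (lookup-padRight m≤t _ (tabulate entry) A) (lookup∘tabulate entry A)

    letter : Fin t → ℕ
    letter = toℕ ∘ proj₂ ∘ lookup rules

    letter-ι : ∀ A → letter (ι A) ≡ toℕ (bit (name L (τ L A)))
    letter-ι A = cong (toℕ ∘ proj₂) (lookup-ι A)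

    rule : Fin t → List (Fin t)
    rule = cut (toList v) ∘ proj₁ ∘ lookup rules

    rule-ι : ∀ A → rule (ι A) ≡ map ι (toList⁺ (R L A))
    rule-ι A = trans (cong (cut (toList v) ∘ proj₁) (lookup-ι A)) (proj₂ (rule-at A))

    simulate : ∀ i → fold (cut (toList v) (proj₁ axiom-at)) (concatMap rule) i ≡ map ι (level L i)
    simulate zero    = proj₂ axiom-at
    simulate (suc i) = begin
      concatMap rule (fold _ (concatMap rule) i)          ≡⟨ cong (concatMap rule) (simulate i) ⟩
      concatMap rule (map ι (level L i))                  ≡⟨ concatMap-map rule ι (level L i) ⟩
      concatMap (rule ∘ ι) (level L i)                    ≡⟨ concatMap-cong rule-ι (level L i) ⟩
      concatMap (map ι ∘ toList⁺ ∘ R L) (level L i)       ≡⟨ map-concatMap ι (toList⁺ ∘ R L) (level L i) ⟨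
      map ι (level L (suc i))                             ∎

  -- The depth of `L` is unbounded, but `prefix-depth` replaces it by one below `t ! * suc (n L)`,
  -- which fits into a code.
  generated⇒decoded : Fin t → ∀ u → Generates L (map toℕ u) →
                      ∃ λ (c : Code t (t ! * suc (n L))) → decode (n L) c ≡ map toℕ u
  generated⇒decoded z u (_ , _ , gen) with prefix-depth m≤t (R L) (n L) (axiom L) (d L)
  ... | e , e< , same = encode z (fromℕ< e<) (n L) u (trans (cong (map (name L ∘ τ L)) same-prefix) gen)
    where
    open ≡-Reasoning
    same-prefix : take (n L) (level L (toℕ (fromℕ< e<))) ≡ take (n L) (level L (d L))
    same-prefix = begin
      take (n L) (level L (toℕ (fromℕ< e<)))                ≡⟨ cong (take (n L) ∘ level L) (toℕ-fromℕ< e<) ⟩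
      take (n L) (level L e)                                ≡⟨ cong (take (n L)) (level-fold L e) ⟩
      take (n L) (fold (axiom L) (substitute (R L)) e)      ≡⟨ same ⟩
      take (n L) (fold (axiom L) (substitute (R L)) (d L))  ≡⟨ cong (take (n L)) (level-fold L (d L)) ⟨
      take (n L) (level L (d L))                            ∎

-- Words given by functions of the position, and counting distinct elements.

module _ {A : Set} where

  applyUpTo-cong : ∀ {f g : ℕ → A} n → (∀ {i} → i < n → f i ≡ g i) → applyUpTo f n ≡ applyUpTo g n
  applyUpTo-cong zero    eq = refl
  applyUpTo-cong (suc n) eq = cong₂ _∷_ (eq z<s) (applyUpTo-cong n (eq ∘ s<s))

  applyUpTo-injective : ∀ {f g : ℕ → A} n → applyUpTo f n ≡ applyUpTo g n → ∀ {i} → i < n → f i ≡ g i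
  applyUpTo-injective (suc n) eq {zero}  _         = ∷-injectiveˡ eq
  applyUpTo-injective (suc n) eq {suc i} (s≤s i<n) = applyUpTo-injective n (∷-injectiveʳ eq) i<n

  take-applyUpTo : ∀ {f : ℕ → A} {k n} → k ≤ n → take k (applyUpTo f n) ≡ applyUpTo f k
  take-applyUpTo z≤n       = refl
  take-applyUpTo (s≤s k≤n) = cong (_ ∷_) (take-applyUpTo k≤n)

  drop-applyUpTo : ∀ (f : ℕ → A) i n → drop i (applyUpTo f n) ≡ applyUpTo (λ j → f (i + j)) (n ∸ i)
  drop-applyUpTo f zero    n       = refl
  drop-applyUpTo f (suc i) zero    = refl
  drop-applyUpTo f (suc i) (suc n) = drop-applyUpTo (f ∘ suc) i n

  -- Delete one occurrence of `x` from `ys`. The other elements of `xs` differ from `x` and survive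
  -- the deletion, so induction applies.
  Unique-⊆⇒length≤ : ∀ {xs ys : List A} → Unique xs → (∀ {z} → z ∈ xs → z ∈ ys) → length xs ≤ length ys
  Unique-⊆⇒length≤ []          _     = z≤n
  Unique-⊆⇒length≤ {x ∷ xs} (x∉ ∷ uniq) xs⊆ with ∈-∃++ (xs⊆ (here refl))
  ... | ys , zs , refl = begin
    suc (length xs)             ≤⟨ s≤s (Unique-⊆⇒length≤ uniq
                                    (λ z∈ → avoid (All.lookup x∉ z∈) (∈-++⁻ ys (xs⊆ (there z∈))))) ⟩
    suc (length (ys ++ zs))     ≡⟨ cong suc (length-++ ys) ⟩
    suc (length ys + length zs) ≡⟨ +-suc (length ys) (length zs) ⟨
    length ys + suc (length zs) ≡⟨ length-++ ys ⟨
    length (ys ++ x ∷ zs)       ∎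
    where
    open ≤-Reasoning
    avoid : ∀ {z} → x ≢ z → _ → z ∈ ys ++ zs
    avoid x≢z (inj₁ z∈ys)         = ∈-++⁺ˡ z∈ys
    avoid x≢z (inj₂ (here refl))  = contradiction refl x≢z
    avoid x≢z (inj₂ (there z∈zs)) = ∈-++⁺ʳ ys z∈zs

indicator : ∀ {P : Set} → Dec P → Fin 2
indicator (yes _) = suc zero
indicator (no _)  = zero

indicator-cong : ∀ {P Q : Set} (P? : Dec P) (Q? : Dec Q) → (P → Q) → (Q → P) → indicator P? ≡ indicator Q?
indicator-cong (yes p) (yes q) f g = refl
indicator-cong (yes p) (no ¬q) f g = contradiction (f p) ¬q
indicator-cong (no ¬p) (yes q) f g = contradiction (g q) ¬p
indicator-cong (no ¬p) (no ¬q) f g = refl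

indicator-transfer : ∀ {P Q : Set} (P? : Dec P) (Q? : Dec Q) → indicator P? ≡ indicator Q? → P → Q
indicator-transfer P?      (yes q) eq p = q
indicator-transfer (no ¬p) (no ¬q) eq p = contradiction p ¬p

-- Words with sparse ones and their distinct substrings.

module _ (k : ℕ) where

  Offsets : Set
  Offsets = Vec (Fin (2 ^ k)) k

  mark : Offsets → Fin k → ℕ
  mark x j = 2 ^ suc (k + toℕ j) + toℕ (lookup x j)

  Marked : Offsets → ℕ → Set
  Marked x i = ∃ λ j → mark x j ≡ i

  marked? : ∀ x i → Dec (Marked x i)
  marked? x i = any? λ j → mark x j ≟ i

  wordLength : ℕ
  wordLength = 2 ^ suc (k + k)

  bits : Offsets → List (Fin 2)
  bits x = applyUpTo (indicator ∘ marked? x) wordLength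

  word : Offsets → Str
  word = map toℕ ∘ bits

  length-word : ∀ x → length (word x) ≡ wordLength
  length-word x = trans (length-map toℕ (bits x)) (length-applyUpTo _ wordLength)

  mark-lower : ∀ x j → 2 * 2 ^ (k + toℕ j) ≤ mark x j
  mark-lower x j = m≤m+n _ (toℕ (lookup x j))

  -- The offset is below `2 ^ k`, hence below `h`. As the next one comes at `4 * h` or later, the
  -- gap between them exceeds `h`.
  mark-upper : ∀ x j → mark x j < 3 * 2 ^ (k + toℕ j)
  mark-upper x j = begin-strict
    2 * h + toℕ (lookup x j)     <⟨ +-monoʳ-< (2 * h)
                                      (<-≤-trans (toℕ<n (lookup x j)) (^-monoʳ-≤ 2 (m≤m+n k (toℕ j)))) ⟩
    2 * h + h                    ≡⟨ +-comm (2 * h) h ⟩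
    3 * h                        ∎
    where
    open ≤-Reasoning
    h = 2 ^ (k + toℕ j)

  mark-<-lower : ∀ y {j j′ : Fin k} → toℕ j < toℕ j′ → 4 * 2 ^ (k + toℕ j) ≤ mark y j′
  mark-<-lower y {j} {j′} j<j′ = begin
    4 * 2 ^ (k + toℕ j)          ≡⟨ *-assoc 2 2 (2 ^ (k + toℕ j)) ⟩
    2 * 2 ^ suc (k + toℕ j)      ≤⟨ *-monoʳ-≤ 2 (^-monoʳ-≤ 2 (+-monoʳ-< k j<j′)) ⟩
    2 * 2 ^ (k + toℕ j′)         ≤⟨ mark-lower y j′ ⟩
    mark y j′                    ∎
    where open ≤-Reasoning

  mark-mono : ∀ x y {j j′} → toℕ j < toℕ j′ → mark x j < mark y j′
  mark-mono x y {j} {j′} j<j′ = <-≤-trans (mark-upper x j)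
    (≤-trans (*-monoˡ-≤ (2 ^ (k + toℕ j)) (n≤1+n 3)) (mark-<-lower y {j} {j′} j<j′))

  -- The ranges of the marks are disjoint for different indices, whatever the offsets. Two offset
  -- vectors are allowed because injectivity of `word` compares two words.
  mark-index : ∀ x y {j j′} → mark x j ≡ mark y j′ → j ≡ j′
  mark-index x y {j} {j′} eq with <-cmp (toℕ j) (toℕ j′)
  ... | tri< j<j′ _ _ = contradiction eq (<⇒≢ (mark-mono x y {j} {j′} j<j′))
  ... | tri≈ _ j≡j′ _ = toℕ-injective j≡j′
  ... | tri> _ _ j>j′ = contradiction (sym eq) (<⇒≢ (mark-mono y x {j′} {j} j>j′))

  mark<wordLength : ∀ x j → mark x j < wordLength
  mark<wordLength x j = begin-strict
    mark x j                  <⟨ mark-upper x j ⟩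
    3 * 2 ^ (k + toℕ j)       ≤⟨ *-monoˡ-≤ (2 ^ (k + toℕ j)) (n≤1+n 3) ⟩
    4 * 2 ^ (k + toℕ j)       ≡⟨ *-assoc 2 2 (2 ^ (k + toℕ j)) ⟩
    2 ^ suc (suc (k + toℕ j)) ≤⟨ ^-monoʳ-≤ 2 (s≤s (+-monoʳ-< k (toℕ<n j))) ⟩
    wordLength                ∎
    where open ≤-Reasoning

  word-≗ : ∀ x → word x ≡ applyUpTo (toℕ ∘ indicator ∘ marked? x) wordLength
  word-≗ x = map-applyUpTo (indicator ∘ marked? x) toℕ wordLength

  -- Equal words put a one of `y` at `mark x j`. By `mark-index` it is the one with index `j`, so
  -- the offsets agree there.
  word-injective : Injective _≡_ _≡_ word
  word-injective {x} {y} eq = lookup-injective λ j → same j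
    (indicator-transfer (marked? x (mark x j)) (marked? y (mark x j))
      (toℕ-injective (applyUpTo-injective wordLength letters≡ (mark<wordLength x j))) (j , refl))
    where
    letters≡ = trans (sym (word-≗ x)) (trans eq (word-≗ y))
    lookup-injective : (∀ j → lookup x j ≡ lookup y j) → x ≡ y
    lookup-injective eqs = trans (sym (tabulate∘lookup x)) (trans (tabulate-cong eqs) (tabulate∘lookup y))
    same : ∀ j → Marked y (mark x j) → lookup x j ≡ lookup y j
    same j (j′ , eq′) with mark-index y x {j′} {j} eq′
    ... | refl = toℕ-injective (+-cancelˡ-≡ (2 ^ suc (k + toℕ j)) _ _ (sym eq′))

  -- Beyond position 4l consecutive ones are more than l apart.
  window-single : ∀ x {l i j j′} → 4 * l ≤ i → i ≤ mark x j → mark x j′ < i + l → ¬ (toℕ j < toℕ j′)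
  window-single x {l} {i} {j} {j′} 4l≤i i≤ <i+l j<j′ =
    <⇒≱ (*-cancelˡ-< 4 l h 4l<4h) (<⇒≤ (+-cancelˡ-< (3 * h) h l 3h+h<3h+l))
    where
    open ≤-Reasoning
    h = 2 ^ (k + toℕ j)
    4l<4h : 4 * l < 4 * h
    4l<4h = begin-strict
      4 * l    ≤⟨ 4l≤i ⟩
      i        ≤⟨ i≤ ⟩
      mark x j <⟨ mark-upper x j ⟩
      3 * h    ≤⟨ *-monoˡ-≤ h (n≤1+n 3) ⟩
      4 * h    ∎
    3h+h<3h+l : 3 * h + h < 3 * h + l
    3h+h<3h+l = begin-strict
      3 * h + h     ≡⟨ +-comm (3 * h) h ⟩
      4 * h         ≤⟨ mark-<-lower x {j} {j′} j<j′ ⟩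
      mark x j′     <⟨ <i+l ⟩
      i + l         ≤⟨ +-monoˡ-≤ l i≤ ⟩
      mark x j + l  <⟨ +-monoˡ-< l (mark-upper x j) ⟩
      3 * h + l     ∎

  -- The value `c = l` lies just outside the window and gives the pattern without a one.
  single : ℕ → ℕ → Str
  single l c = applyUpTo (λ i → toℕ (indicator (c ≟ i))) l

  -- Windows that start before `4 * l` are simply listed; starts too close to the end of the word
  -- only lengthen the list. All later windows have the form `single l c`.
  patterns : ℕ → Str → List Str
  patterns l w = map (λ i → take l (drop i w)) (upTo (4 * l)) ++ map (single l) (upTo (suc l))

  length-patterns : ∀ l w → length (patterns l w) ≡ 4 * l + suc l
  length-patterns l w = trans (length-++ (map _ (upTo (4 * l))))
    (cong₂ _+_ (trans (length-map _ (upTo (4 * l))) (length-upTo (4 * l)))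
               (trans (length-map _ (upTo (suc l))) (length-upTo (suc l))))

  window-≗ : ∀ x {i l} → i + l ≤ wordLength →
             take l (drop i (word x)) ≡ applyUpTo (λ j → toℕ (indicator (marked? x (i + j)))) l
  window-≗ x {i} {l} i+l≤n = trans (cong (take l ∘ drop i) (word-≗ x))
    (trans (cong (take l) (drop-applyUpTo _ i wordLength)) (take-applyUpTo (m+n≤o⇒m≤o∸n l (≤-trans (≤-reflexive (+-comm l i)) i+l≤n))))

  -- By `window-single` two ones cannot both fall into the window, so it is described by the place
  -- of its one, or by `l` if there is none.
  late-window : ∀ x {i l} → 4 * l ≤ i → i + l ≤ wordLength →
                ∃ λ c → c < suc l × take l (drop i (word x)) ≡ single l c
  late-window x {i} {l} 4l≤i i+l≤n with any? {n = l} (λ c → marked? x (i + toℕ c))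
  ... | yes (c , j , eq) = toℕ c , m<n⇒m<1+n (toℕ<n c) , trans (window-≗ x i+l≤n)
    (applyUpTo-cong l λ {i′} i′<l → cong toℕ (indicator-cong (marked? x (i + i′)) (toℕ c ≟ i′)
      (λ { (j′ , eq′) → +-cancelˡ-≡ i (toℕ c) i′ (trans (sym eq) (trans (cong (mark x) (unique i′<l eq′)) eq′)) })
      (λ { refl → j , eq })))
    where
    inside : ∀ {j i′} → mark x j ≡ i + i′ → i ≤ mark x j
    inside eq = ≤-trans (m≤m+n i _) (≤-reflexive (sym eq))
    before : ∀ {j i′} → i′ < l → mark x j ≡ i + i′ → mark x j < i + l
    before i′<l eq = ≤-<-trans (≤-reflexive eq) (+-monoʳ-< i i′<l)
    unique : ∀ {j′ i′} → i′ < l → mark x j′ ≡ i + i′ → j ≡ j′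
    unique {j′} i′<l eq′ with <-cmp (toℕ j) (toℕ j′)
    ... | tri< j<j′ _ _ = contradiction j<j′
      (window-single x {l} {i} {j} {j′} 4l≤i (inside {j} eq) (before {j′} i′<l eq′))
    ... | tri≈ _ j≡j′ _ = toℕ-injective j≡j′
    ... | tri> _ _ j>j′ = contradiction j>j′
      (window-single x {l} {i} {j′} {j} 4l≤i (inside {j′} eq′) (before {j} (toℕ<n c) eq))
  ... | no ¬c = l , n<1+n l , trans (window-≗ x i+l≤n)
    (applyUpTo-cong l λ {i′} i′<l → cong toℕ (indicator-cong (marked? x (i + i′)) (l ≟ i′)
      (λ marked → contradiction
        (fromℕ< i′<l , subst (λ z → Marked x (i + z)) (sym (toℕ-fromℕ< i′<l)) marked) ¬c)
      (λ l≡i′ → contradiction (sym l≡i′) (<⇒≢ i′<l))))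

  windows⊆patterns : ∀ x {l} → l ≤ wordLength → ∀ {z} → z ∈ windows l (word x) → z ∈ patterns l (word x)
  windows⊆patterns x {l} l≤n z∈ with ∈-map⁻ (λ i → take l (drop i (word x))) z∈
  ... | i , i∈ , refl with i <? 4 * l
  ...   | yes i<4l = ∈-++⁺ˡ (∈-map⁺ _ (∈-upTo⁺ i<4l))
  ...   | no i≮4l with late-window x {i} {l} (≮⇒≥ i≮4l) i+l≤n
    where
    i+l≤n : i + l ≤ wordLength
    i+l≤n = begin
      i + l                ≤⟨ +-monoˡ-≤ l (≤-pred (∈-upTo⁻ i∈)) ⟩
      length (word x) ∸ l + l ≡⟨ cong (λ z → z ∸ l + l) (length-word x) ⟩
      wordLength ∸ l + l   ≡⟨ m∸n+n≡m l≤n ⟩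
      wordLength           ∎
      where open ≤-Reasoning
  ...     | c , c< , eq = ∈-++⁺ʳ _ (subst (_∈ _) (sym eq) (∈-map⁺ (single l) (∈-upTo⁺ c<)))

  -- There are `4 * l` early windows and `suc l` late patterns; `5l + 1` is at most `6l` because `l`
  -- is positive.
  S-word : ∀ x l → .{{NonZero l}} → l ≤ wordLength → S (word x) l ≤ 6 * l
  S-word x l l≤n = begin
    S (word x) l                    ≤⟨ Unique-⊆⇒length≤
                                         (deduplicate-! (≡-dec _≟_) (windows l (word x)))
                                         (windows⊆patterns x l≤n ∘ ∈-deduplicate⁻ (≡-dec _≟_) (windows l (word x))) ⟩
    length (patterns l (word x))    ≡⟨ length-patterns l (word x) ⟩
    4 * l + suc l                   ≤⟨ +-monoʳ-≤ (4 * l) (+-monoˡ-≤ l (>-nonZero⁻¹ l)) ⟩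
    4 * l + (l + l)                 ≡⟨ solve 1 (λ l → con 4 :* l :+ (l :+ l) := con 6 :* l) refl l ⟩
    6 * l                           ∎
    where
    open ≤-Reasoning
    open +-*-Solver

-- Fewer codes than words, and the choice of a hard word.

n<2^n : ∀ n → n < 2 ^ n
n<2^n zero    = z<s
n<2^n (suc n) = begin-strict
  suc n           <⟨ s<s (n<2^n n) ⟩
  1 + 2 ^ n       ≤⟨ +-mono-≤ (m^n>0 2 n) (≤-reflexive (sym (+-identityʳ (2 ^ n)))) ⟩
  2 ^ suc n       ∎
  where open ≤-Reasoning

n!≤n^n : ∀ n → n ! ≤ n ^ n
n!≤n^n zero    = ≤-refl
n!≤n^n (suc n) = *-monoʳ-≤ (suc n) (≤-trans (n!≤n^n n) (^-monoˡ-≤ n (n≤1+n n)))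

^-bound : ∀ {a} e k → a ≤ 2 ^ e → a ^ k ≤ 2 ^ (e * k)
^-bound e k a≤ = ≤-trans (^-monoˡ-≤ k a≤) (≤-reflexive (^-*-assoc 2 e k))

*-bound : ∀ {a b} d e → a ≤ 2 ^ d → b ≤ 2 ^ e → a * b ≤ 2 ^ (d + e)
*-bound d e a≤ b≤ = ≤-trans (*-mono-≤ a≤ b≤) (≤-reflexive (sym (^-distribˡ-+-* 2 d e)))

module _ (u : ℕ) where

  private
    t = suc u
    k = 5 * t

    -- The summands bound, in order, the binary logarithms of the numbers of texts, rule tables and
    -- axiom positions, then of `t !` and of `suc (wordLength k)`. With `k = 5t` they add up to
    -- `4t² + 13t + 2`, which is below `25t²` for every `t ≥ 1`.
    exponent : ℕ
    exponent = t * t + ((t + t + 1) * t + (t + t + (t * t + suc (suc (k + k)))))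

    exponent<k² : exponent < k * k
    exponent<k² = subst (suc exponent ≤_)
      (solve 1 (λ u → let t = con 1 :+ u ; k = con 5 :* t in
        con 1 :+ (t :* t :+ ((t :+ t :+ con 1) :* t :+ (t :+ t :+ (t :* t :+ (con 2 :+ (k :+ k))))))
          -- This polynomial in `u` is the slack `k * k ∸ suc exponent`; its coefficients are
          -- nonnegative.
          :+ (con 21 :* u :* u :+ con 29 :* u :+ con 5) := k :* k) refl u)
      (m≤m+n (suc exponent) _)
      where open +-*-Solver

  few-codes : #codes t (t ! * suc (wordLength k)) < (2 ^ k) ^ k
  few-codes = begin-strict
    #codes t (t ! * suc (wordLength k)) ≤⟨
      *-bound (t * t) _ (^-bound t t t≤)
        (*-bound ((t + t + 1) * t) _ (^-bound (t + t + 1) t (*-bound (t + t) 1 position≤ ≤-refl))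
          (*-bound (t + t) _ position≤ (*-bound (t * t) _ (≤-trans (n!≤n^n t) (^-bound t t t≤)) n≤))) ⟩
    2 ^ exponent  <⟨ ^-monoʳ-< 2 ≤-refl exponent<k² ⟩
    2 ^ (k * k)   ≡⟨ ^-*-assoc 2 k k ⟨
    (2 ^ k) ^ k   ∎
    where
    open ≤-Reasoning
    t≤ : t ≤ 2 ^ t
    t≤ = <⇒≤ (n<2^n t)
    position≤ : suc t * suc t ≤ 2 ^ (t + t)
    position≤ = *-bound t t (n<2^n t) (n<2^n t)
    n≤ : suc (wordLength k) ≤ 2 ^ suc (suc (k + k))
    n≤ = +-mono-≤ (m^n>0 2 (suc (k + k))) (≤-reflexive (sym (+-identityʳ (wordLength k))))

  private
    offsets : Fin ((2 ^ k) ^ k) → Offsets k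
    offsets = Inverse.from (Vec↔Fin (↔-id _) k)

    codes : Fin (#codes t (t ! * suc (wordLength k))) → Code t (t ! * suc (wordLength k))
    codes = Inverse.from (Code↔Fin t _)

    uncovered : ∃ λ i → ∀ j → decode (wordLength k) (codes j) ≢ word k (offsets i)
    uncovered = ¬covers (≡-dec _≟_) few-codes (decode (wordLength k) ∘ codes) (word k ∘ offsets)
      (λ eq → from-injective (word-injective k eq))
      where
      from-injective : ∀ {i j} → offsets i ≡ offsets j → i ≡ j
      from-injective {i} {j} eq = trans (sym (Inverse.strictlyInverseˡ V i))
        (trans (cong (Inverse.to V) eq) (Inverse.strictlyInverseˡ V j))
        where V = Vec↔Fin (↔-id (Fin (2 ^ k))) k

  abstract
    -- Only undecodability is used of this choice; sealing it keeps the pigeonhole search from being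
    -- unfolded.
    hardOffsets : Offsets k
    hardOffsets = offsets (proj₁ uncovered)

    hardOffsets-undecodable : ∀ (c : Code t (t ! * suc (wordLength k))) → decode (wordLength k) c ≢ word k hardOffsets
    hardOffsets-undecodable c eq = proj₂ uncovered (Inverse.to (Code↔Fin t _) c)
      (trans (cong (decode (wordLength k)) (Inverse.strictlyInverseʳ (Code↔Fin t _) c)) eq)

  hardWord : Str
  hardWord = word k hardOffsets

  -- A generating system of size at most `t` would have a code that decodes to the word, which was
  -- chosen outside the range of `decode`.
  size-hardWord : ∀ L → Generates L hardWord → t < size L
  size-hardWord L gen with t <? size L
  ... | yes t<   = t<
  ... | no t≮ with generated⇒decoded L (≮⇒≥ t≮) zero (bits k hardOffsets) gen
  ...   | c , eq = contradiction eq (undecodable (n L) (trans (proj₁ gen) (length-word k hardOffsets)) c)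
    where
    -- The type of the code depends on the length, so the length is generalised to a variable before
    -- being identified with `wordLength k`.
    undecodable : ∀ n′ → n′ ≡ wordLength k → ∀ (c : Code t (t ! * suc n′)) → decode n′ c ≢ hardWord
    undecodable _ refl = hardOffsets-undecodable

-- Rational inequalities and the final estimate.

open ℤ using (+_)

-- On unnormalised fractions the order is cross-multiplication; the detour avoids the reduction to
-- lowest terms.
fraction-mono : ∀ a b c d → a * suc d ≤ b * suc c → (+ a) ℚ./ suc c ≤ℚ (+ b) ℚ./ suc d
fraction-mono a b c d ad≤bc = ℚₚ.toℚᵘ-cancel-≤ (begin
  ℚ.toℚᵘ ((+ a) ℚ./ suc c)  ≃⟨ ℚₚ.toℚᵘ-fromℚᵘ (mkℚᵘ (+ a) c) ⟩
  mkℚᵘ (+ a) c              ≤⟨ ℚᵘ.*≤* (subst₂ ℤ._≤_ (ℤₚ.pos-* a (suc d)) (ℤₚ.pos-* b (suc c)) (ℤ.+≤+ ad≤bc)) ⟩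
  mkℚᵘ (+ b) d              ≃⟨ ℚₚ.toℚᵘ-fromℚᵘ (mkℚᵘ (+ b) d) ⟨
  ℚ.toℚᵘ ((+ b) ℚ./ suc d)  ∎)
  where open ℚᵘₚ.≤-Reasoning

fraction-* : ∀ a c b d → (+ a ℚ./ suc c) ℚ.* (+ b ℚ./ suc d) ≡ + (a * b) ℚ./ (suc c * suc d)
fraction-* a c b d = ℚₚ.toℚᵘ-injective (begin-equality
  ℚ.toℚᵘ ((+ a ℚ./ suc c) ℚ.* (+ b ℚ./ suc d))           ≃⟨ ℚₚ.toℚᵘ-homo-* (+ a ℚ./ suc c) (+ b ℚ./ suc d) ⟩
  ℚ.toℚᵘ (+ a ℚ./ suc c) ℚᵘ.* ℚ.toℚᵘ (+ b ℚ./ suc d)     ≃⟨ ℚᵘₚ.*-cong (ℚₚ.toℚᵘ-fromℚᵘ (mkℚᵘ (+ a) c)) (ℚₚ.toℚᵘ-fromℚᵘ (mkℚᵘ (+ b) d)) ⟩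
  mkℚᵘ (+ a) c ℚᵘ.* mkℚᵘ (+ b) d                         ≡⟨ cong (λ z → mkℚᵘ z (d + c * suc d)) (sym (ℤₚ.pos-* a b)) ⟩
  mkℚᵘ (+ (a * b)) (d + c * suc d)                       ≃⟨ ℚₚ.toℚᵘ-fromℚᵘ (mkℚᵘ (+ (a * b)) (d + c * suc d)) ⟨
  ℚ.toℚᵘ (+ (a * b) ℚ./ (suc c * suc d))                 ∎)
  where open ℚᵘₚ.≤-Reasoning

foldr-⊔-lub : ∀ {q} → 0ℚ ≤ℚ q → ∀ {ps} → All (_≤ℚ q) ps → foldr ℚ._⊔_ 0ℚ ps ≤ℚ q
foldr-⊔-lub 0≤q []           = 0≤q
foldr-⊔-lub 0≤q (p≤q ∷ ps≤q) = ℚₚ.⊔-lub p≤q (foldr-⊔-lub 0≤q ps≤q)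

δ-word : ∀ k x → δ (word k x) ≤ℚ (+ 6) ℚ./ 1
δ-word k x = foldr-⊔-lub (ℚₚ.nonNegative⁻¹ ((+ 6) ℚ./ 1)) (Allₚ.map⁺ (All.tabulate λ {j} j∈ →
  fraction-mono (S (word k x) (suc j)) 6 j 0
    (≤-trans (≤-reflexive (*-identityʳ _))
      (S-word k x (suc j) (subst (suc j ≤_) (length-word k x) (∈-upTo⁻ j∈))))))

-- 66 = 6 · 11, from δ ≤ 6 and log n = 10t + 1 ≤ 11t.
C : ℚ
C = (+ 1) ℚ./ 66

size-lower-bound : ∀ u L → Generates L (hardWord u) →
                   C ℚ.* δ (hardWord u) ℚ.* ((+ ⌊log₂ length (hardWord u) ⌋) ℚ./ 1) ≤ℚ (+ size L) ℚ./ 1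
size-lower-bound u L gen = begin
  C ℚ.* δ w ℚ.* ((+ ⌊log₂ length w ⌋) ℚ./ 1) ≡⟨ cong (λ l → C ℚ.* δ w ℚ.* ((+ l) ℚ./ 1)) log≡ ⟩
  C ℚ.* δ w ℚ.* ((+ lg) ℚ./ 1)               ≤⟨ ℚₚ.*-monoʳ-≤-nonNeg _ {{ℚₚ.normalize-nonNeg lg 1}}
                                                 (ℚₚ.*-monoˡ-≤-nonNeg C (δ-word (5 * suc u) (hardOffsets u))) ⟩
  -- The product of `C` and the bound 6 evaluates to 1/11.
  (+ 1) ℚ./ 11 ℚ.* ((+ lg) ℚ./ 1)            ≡⟨ fraction-* 1 10 lg 0 ⟩
  + (1 * lg) ℚ./ 11                          ≤⟨ fraction-mono (1 * lg) (size L) 10 0 lg≤ ⟩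
  (+ size L) ℚ./ 1                           ∎
  where
  open ℚₚ.≤-Reasoning
  w  = hardWord u
  lg = suc (5 * suc u + 5 * suc u)
  log≡ : ⌊log₂ length w ⌋ ≡ lg
  log≡ = trans (cong ⌊log₂_⌋ (length-word (5 * suc u) (hardOffsets u))) (⌊log₂[2^n]⌋≡n lg)
  lg≤ : 1 * lg * 1 ≤ size L * 11
  -- With `t = 1 + u` the difference between `11t` and `10t + 1` is `u`.
  lg≤ = ≤-trans (m+n≤o⇒m≤o (1 * lg * 1) {u} (≤-reflexive
      (solve 1 (λ u → let t = con 1 :+ u in
        con 1 :* (con 1 :+ (con 5 :* t :+ con 5 :* t)) :* con 1 :+ u := t :* con 11) refl u)))
    (*-monoˡ-≤ 11 (<⇒≤ (size-hardWord u L gen)))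
    where open +-*-Solver

theorem4 : Σ (Str → Set) λ Family →
    ((N : ℕ) → Σ Str λ w → Family w × N ≤ length w) ×
    Σ ℚ λ C → (0ℚ ℚ.< C) ×
    ((w : Str) → Family w → 2 ≤ length w → (L : LSystem) → Generates L w →
    C ℚ.* δ w ℚ.* ((+ ⌊log₂ length w ⌋) ℚ./ 1) ≤ℚ ((+ size L) ℚ./ 1))
theorem4 = (λ w → ∃ λ u → w ≡ hardWord u) , (λ N → hardWord N , (N , refl) , long N) ,
           C , ℚₚ.positive⁻¹ C , λ { _ (u , refl) _ L gen → size-lower-bound u L gen }
  where
  long : ∀ N → N ≤ length (hardWord N)
  long N = begin
    N                                   ≤⟨ n≤1+n N ⟩
    suc N                               ≤⟨ m≤n*m (suc N) 5 ⟩
    5 * suc N                           ≤⟨ m≤m+n (5 * suc N) (5 * suc N) ⟩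
    5 * suc N + 5 * suc N               ≤⟨ n≤1+n _ ⟩
    suc (5 * suc N + 5 * suc N)         <⟨ n<2^n _ ⟩
    wordLength (5 * suc N)              ≡⟨ length-word (5 * suc N) (hardOffsets N) ⟨
    length (hardWord N)                 ∎
    where open ≤-Reasoning
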